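{- For positive integers $\ell,m$, let $A(\ell,m)$ be the $(\ell+m)\times(\ell+m)$ coloring matrix with entries $a_{ij}=0$ if $i,j>\ell$ and $a_{ij}=1$ otherwise. Then for $1\le i\le\ell$, $$\ell^2F_{A(\ell,m)}^{(i)}(x)^3-2\ell F_{A(\ell,m)}^{(i)}(x)^2+((\ell-m)x+1)F_{A(\ell,m)}^{(i)}(x)-x=0,$$ and for $\ell+1\le i\le\ell+m$, $$mF_{A(\ell,m)}^{(i)}(x)^3+(\ell-m)xF_{A(\ell,m)}^{(i)}(x)^2-xF_{A(\ell,m)}^{(i)}(x)+x^2=0.$$
   Context: A plane tree is an unlabeled rooted tree in which the children of every vertex are linearly ordered. A coloring matrix is a square matrix $A=(a_{ij})$ with entries in $\{0,1\}$. An $A$-coloring of a plane tree assigns to each vertex a color (an index of a row of $A$) such that whenever a vertex of color $j$ is a child of a vertex of color $i$, $a_{ij}=1$. Let $t_A^{(i)}(n)$ be the number of pairs (plane tree with $n$ vertices, $A$-coloring of it) with root color $i$, and $F_A^{(i)}(x)=\sum_{n\ge1}t_A^{(i)}(n)x^n$ (formal power series). -}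

module Defs where

open import Axiom.UniquenessOfIdentityProofs using (module Decidable⇒UIP)
open import Data.Bool using (if_then_else_; _∧_)
open import Data.Empty using (⊥-elim)
open import Data.Fin using (Fin; toℕ; zero; suc)
open import Data.Fin.Patterns using (0F; 1F)
open import Data.Fin.Properties using (1↔⊤; +↔⊎) renaming (_≟_ to _≟ᶠ_)
open import Data.Integer using (ℤ; +_; 0ℤ; 1ℤ)
import Data.Integer as ℤ
open import Data.Integer.Properties using (+-*-semiring)
open import Data.List using (List; []; _∷_)
open import Data.List.Relation.Unary.All using (All; []; _∷_)
open import Data.Nat using (ℕ; zero; suc; _∸_; _≤_; _≤ᵇ_; _≤?_; z≤n)
import Data.Nat as ℕ
open import Data.Nat.Properties using (≤-irrelevant; ≡-irrelevant; ≤-trans; m≤m+n; m≤n+m) renaming (_≟_ to _≟ⁿ_)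
open import Data.Product using (Σ; Σ-syntax; ∃; _×_; _,_; proj₁; proj₂)
open import Data.Product.Function.Dependent.Propositional using (Σ-↔)
open import Data.Sum using (_⊎_; inj₁; inj₂)
open import Data.Sum.Function.Propositional using (_⊎-↔_)
open import Data.Unit using (⊤; tt)
open import Function.Bundles using (_↔_; mk↔ₛ′; Inverse)
open import Function.Properties.Inverse using (↔-refl; ↔-trans)
open import Relation.Binary.PropositionalEquality using (_≡_; refl; cong; cong₂)
open import Relation.Nullary using (Dec; yes; no; Irrelevant)
open import Relation.Nullary.Decidable using (_×-dec_)
open import Algebra.Properties.Semiring.Sum +-*-semiring using (sum)

data PlaneTree : Set where
  node : List PlaneTree → PlaneTree

mutual
  size : PlaneTree → ℕ
  size (node ts) = suc (sizes ts)

  sizes : List PlaneTree → ℕ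
  sizes []       = 0
  sizes (t ∷ ts) = size t ℕ.+ sizes ts

ColoringMatrix : ℕ → Set
ColoringMatrix k = Fin k → Fin k → Fin 2

-- An assignment of a color to every vertex: one for the root, and recursively
-- one for every vertex of each of its subtrees.
data Coloring (k : ℕ) : PlaneTree → Set where
  color : ∀ {ts} → Fin k → All (Coloring k) ts → Coloring k (node ts)

rootColor : ∀ {k t} → Coloring k t → Fin k
rootColor (color i _) = i

mutual
  IsColoring : ∀ {k t} → ColoringMatrix k → Coloring k t → Set
  IsColoring A (color i cs) = AllowedBelow A i cs

  AllowedBelow : ∀ {k ts} → ColoringMatrix k → Fin k → All (Coloring k) ts → Set
  AllowedBelow A i []       = ⊤
  AllowedBelow A i (c ∷ cs) = (A i (rootColor c) ≡ 1F × IsColoring A c) × AllowedBelow A i cs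

PlaneTreeOfSize : ℕ → Set
PlaneTreeOfSize n = Σ[ t ∈ PlaneTree ] size t ≡ n

ColoredTree : ∀ {k} → ColoringMatrix k → Fin k → ℕ → Set
ColoredTree {k} A i n =
  Σ[ t ∈ PlaneTreeOfSize n ] Σ[ c ∈ Coloring k (proj₁ t) ] (IsColoring A c × rootColor c ≡ i)

-- A cardinality together with a bijection witnessing it.
Finite : Set → Set
Finite X = ∃ λ k → Fin k ↔ X

card : ∀ {X} → Finite X → ℕ
card = proj₁

module _ where
  private variable
    X Y : Set

  finite-via : X ↔ Y → Finite X → Finite Y
  finite-via e (k , f) = k , ↔-trans f e

  finite-⊤ : Finite ⊤
  finite-⊤ = 1 , 1↔⊤

  finite-Fin : ∀ {n} → Finite (Fin n)
  finite-Fin = _ , ↔-refl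

  finite-dec : Dec X → Irrelevant X → Finite X
  finite-dec (yes x) irr = finite-via (mk↔ₛ′ (λ _ → x) (λ _ → tt) (irr x) (λ _ → refl)) finite-⊤
  finite-dec (no ¬x) _   = 0 , mk↔ₛ′ (λ ()) (λ x → ⊥-elim (¬x x)) (λ x → ⊥-elim (¬x x)) (λ ())

  finite-⊎ : Finite X → Finite Y → Finite (X ⊎ Y)
  finite-⊎ (a , f) (b , g) = a ℕ.+ b , ↔-trans +↔⊎ (f ⊎-↔ g)

  finite-ΣFin : ∀ {n} {B : Fin n → Set} → (∀ i → Finite (B i)) → Finite (Σ (Fin n) B)
  finite-ΣFin {zero}  h = 0 , mk↔ₛ′ (λ ()) (λ ()) (λ ()) (λ ())
  finite-ΣFin {suc n} h =
    finite-via
      (mk↔ₛ′ (λ { (inj₁ b) → zero , b ; (inj₂ (i , b)) → suc i , b })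
             (λ { (zero , b) → inj₁ b ; (suc i , b) → inj₂ (i , b) })
             (λ { (zero , b) → refl ; (suc i , b) → refl })
             (λ { (inj₁ b) → refl ; (inj₂ (i , b)) → refl }))
      (finite-⊎ (h zero) (finite-ΣFin (λ i → h (suc i))))

  finite-Σ : {B : X → Set} → Finite X → (∀ x → Finite (B x)) → Finite (Σ X B)
  finite-Σ (k , f) h = finite-via (Σ-↔ f ↔-refl) (finite-ΣFin (λ i → h (Inverse.to f i)))

  finite-× : Finite X → Finite Y → Finite (X × Y)
  finite-× p q = finite-Σ p (λ _ → q)

×-irrelevant : ∀ {P Q : Set} → Irrelevant P → Irrelevant Q → Irrelevant (P × Q)
×-irrelevant p q (a , b) (c , d) = cong₂ _,_ (p a c) (q b d)

Fin-≡-irrelevant : ∀ {n} {i j : Fin n} → Irrelevant (i ≡ j)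
Fin-≡-irrelevant = Decidable⇒UIP.≡-irrelevant _≟ᶠ_

ForestUpTo : ℕ → Set
ForestUpTo n = Σ[ ts ∈ List PlaneTree ] sizes ts ≤ n

finite-ForestUpTo : ∀ n → Finite (ForestUpTo n)
finite-ForestUpTo zero =
  finite-via
    (mk↔ₛ′ (λ _ → [] , z≤n) (λ _ → tt)
           (λ { ([] , z≤n) → refl ; (node _ ∷ _ , ()) }) (λ _ → refl))
    finite-⊤
finite-ForestUpTo (suc n) =
  finite-via (mk↔ₛ′ to from to∘from from∘to)
    (finite-⊎ finite-⊤
      (finite-Σ (finite-× (finite-ForestUpTo n) (finite-ForestUpTo n))
        (λ p → finite-dec (_ ≤? _) ≤-irrelevant)))
  where
  Split : Set
  Split = Σ[ p ∈ ForestUpTo n × ForestUpTo n ]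
            sizes (proj₁ (proj₁ p)) ℕ.+ sizes (proj₁ (proj₂ p)) ≤ n

  to : ⊤ ⊎ Split → ForestUpTo (suc n)
  to (inj₁ _) = [] , z≤n
  to (inj₂ (((ts , _) , (us , _)) , le)) = node ts ∷ us , ℕ.s≤s le

  from : ForestUpTo (suc n) → ⊤ ⊎ Split
  from ([] , _) = inj₁ tt
  from (node ts ∷ us , ℕ.s≤s le) =
    inj₂ (((ts , ≤-trans (m≤m+n _ _) le) , (us , ≤-trans (m≤n+m _ (sizes ts)) le)) , le)

  to∘from : ∀ y → to (from y) ≡ y
  to∘from ([] , z≤n) = refl
  to∘from (node ts ∷ us , ℕ.s≤s le) = refl

  from∘to : ∀ x → from (to x) ≡ x
  from∘to (inj₁ tt) = refl
  from∘to (inj₂ (((ts , p) , (us , q)) , le)) =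
    cong₂ (λ p q → inj₂ (((ts , p) , (us , q)) , le)) (≤-irrelevant _ _) (≤-irrelevant _ _)

finite-PlaneTreeOfSize : ∀ n → Finite (PlaneTreeOfSize n)
finite-PlaneTreeOfSize n =
  finite-via
    (mk↔ₛ′ (λ { ((ts , _) , eq) → node ts , eq })
           (λ { (node ts , refl) → (ts , m≤n+m _ 1) , refl })
           (λ { (node ts , refl) → refl })
           (λ { ((ts , p) , refl) → cong (λ p → (ts , p) , refl) (≤-irrelevant _ _) }))
    (finite-Σ (finite-ForestUpTo n) (λ _ → finite-dec (_ ≟ⁿ _) ≡-irrelevant))

mutual
  finite-Coloring : ∀ {k} t → Finite (Coloring k t)
  finite-Coloring (node ts) =
    finite-via
      (mk↔ₛ′ (λ { (i , cs) → color i cs }) (λ { (color i cs) → i , cs })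
             (λ { (color i cs) → refl }) (λ { (i , cs) → refl }))
      (finite-× finite-Fin (finite-Colorings ts))

  finite-Colorings : ∀ {k} ts → Finite (All (Coloring k) ts)
  finite-Colorings [] =
    finite-via (mk↔ₛ′ (λ _ → []) (λ _ → tt) (λ { [] → refl }) (λ _ → refl)) finite-⊤
  finite-Colorings (t ∷ ts) =
    finite-via
      (mk↔ₛ′ (λ { (c , cs) → c ∷ cs }) (λ { (c ∷ cs) → c , cs })
             (λ { (c ∷ cs) → refl }) (λ { (c , cs) → refl }))
      (finite-× (finite-Coloring t) (finite-Colorings ts))

module _ {k : ℕ} (A : ColoringMatrix k) where
  mutual
    isColoring? : ∀ {t} (c : Coloring k t) → Dec (IsColoring A c)
    isColoring? (color i cs) = allowedBelow? i cs

    allowedBelow? : ∀ {ts} i (cs : All (Coloring k) ts) → Dec (AllowedBelow A i cs)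
    allowedBelow? i []       = yes tt
    allowedBelow? i (c ∷ cs) =
      ((A i (rootColor c) ≟ᶠ 1F) ×-dec isColoring? c) ×-dec allowedBelow? i cs

  mutual
    isColoring-irrelevant : ∀ {t} (c : Coloring k t) → Irrelevant (IsColoring A c)
    isColoring-irrelevant (color i cs) = allowedBelow-irrelevant i cs

    allowedBelow-irrelevant : ∀ {ts} i (cs : All (Coloring k) ts) → Irrelevant (AllowedBelow A i cs)
    allowedBelow-irrelevant i []       _ _ = refl
    allowedBelow-irrelevant i (c ∷ cs) =
      ×-irrelevant (×-irrelevant Fin-≡-irrelevant (isColoring-irrelevant c))
                   (allowedBelow-irrelevant i cs)

  finite-ColoredTree : ∀ i n → Finite (ColoredTree A i n)
  finite-ColoredTree i n =
    finite-Σ (finite-PlaneTreeOfSize n) λ t →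
    finite-Σ (finite-Coloring (proj₁ t)) λ c →
    finite-dec (isColoring? c ×-dec (rootColor c ≟ᶠ i))
               (×-irrelevant (isColoring-irrelevant c) Fin-≡-irrelevant)

treeCount : ∀ {k} → ColoringMatrix k → Fin k → ℕ → ℕ
treeCount A i n = card (finite-ColoredTree A i n)

-- Formal power series over ℤ: f n is the coefficient of xⁿ.
PowerSeries : Set
PowerSeries = ℕ → ℤ

infixl 6 _+_ _-_
infixl 7 _*_
infixr 8 _^_

_+_ _-_ _*_ : PowerSeries → PowerSeries → PowerSeries
(f + g) n = f n ℤ.+ g n
(f - g) n = f n ℤ.- g n
(f * g) n = sum {suc n} λ j → f (toℕ j) ℤ.* g (n ∸ toℕ j)

const : ℤ → PowerSeries
const a zero    = a
const a (suc _) = 0ℤ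

x : PowerSeries
x 1 = 1ℤ
x _ = 0ℤ

_^_ : PowerSeries → ℕ → PowerSeries
f ^ zero  = const 1ℤ
f ^ suc n = f * f ^ n

F : ∀ {k} → ColoringMatrix k → Fin k → PowerSeries
F A i zero      = 0ℤ
F A i n@(suc _) = + treeCount A i n

-- Indices of Fin are shifted by one, so "i > ℓ" reads ℓ ≤ toℕ i.
A : ∀ ℓ m → ColoringMatrix (ℓ ℕ.+ m)
A ℓ m i j = if (ℓ ≤ᵇ toℕ i) ∧ (ℓ ≤ᵇ toℕ j) then 0F else 1F

{-# OPTIONS --safe #-}

-- Detaching the subtree of the first child of the root splits a colored tree
-- into two colored trees, so F_i = x + Σ_j a_ij F_j F_i. A color enters only
-- through its row of the matrix, so for A(ℓ, m) there are two distinct series: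
--   P = x + (ℓ P + m Q) P  (colors ≤ ℓ)   and   Q = x + ℓ P Q  (colors > ℓ).
-- Both cubics lie in the ideal generated by these two equations.
module Submission where

open import Defs using (A; F; x; const; _+_; _-_; _*_; _^_)
open import Defs using (PowerSeries; node; size; Coloring; color; rootColor; IsColoring; AllowedBelow)
open import Defs using (ColoringMatrix; ColoredTree; Finite; card; treeCount; finite-ColoredTree; finite-dec; finite-⊎; finite-×; finite-ΣFin; allowedBelow-irrelevant; Fin-≡-irrelevant)
open import Algebra.Bundles using (CommutativeRing)
import Algebra.Construct.Pointwise as Pointwise
import Algebra.Solver.Ring as RingSolver
open import Algebra.Solver.Ring.AlmostCommutativeRing using (fromCommutativeRing; _-Raw-AlmostCommutative⟶_)
open import Data.Bool using (true; false; T; if_then_else_)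
open import Data.Bool.Properties using (∧-comm)
open import Data.Fin using (Fin; toℕ; zero; suc; fromℕ<)
open import Data.Fin.Patterns using (0F; 1F)
open import Data.Fin.Permutation using (↔⇒≡)
open import Data.Fin.Properties using (toℕ-injective; toℕ-fromℕ<; toℕ≤pred[n]) renaming (_≟_ to _≟ᶠ_)
open import Data.Integer using (ℤ; +_; 0ℤ; 1ℤ)
import Data.Integer as ℤ
import Data.Integer.Properties as ℤ
open import Data.Integer.Solver using (module +-*-Solver)
open import Data.List using ([]; _∷_)
open import Data.List.Relation.Unary.All using (All; []; _∷_)
import Data.Maybe as Maybe
open import Data.Nat using (ℕ; _≤_; _<_; NonZero; >-nonZero⁻¹; zero; suc; _∸_; z≤n; s≤s; z<s; _≤ᵇ_; _≤?_)
open import Data.Nat.Properties using (+-suc; m+n∸m≡n; m+[n∸m]≡n; m≤m+n; m<m+n; ≤-reflexive; ≤-trans; <⇒≱; ≰⇒>; ≤ᵇ⇒≤; ≤⇒≤ᵇ; ≡-irrelevant) renaming (_≟_ to _≟ⁿ_)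
open import Data.Product using (Σ-syntax; _×_; _,_)
open import Data.Sum using (_⊎_; inj₁; inj₂)
open import Data.Unit using (tt)
open import Function using (_∘_)
open import Function.Bundles using (_↔_; mk↔ₛ′)
open import Function.Properties.Inverse using (↔-sym; ↔-trans)
open import Level using (0ℓ)
open import Relation.Binary.PropositionalEquality using (_≗_; _≡_; refl; sym; trans; cong; cong₂; subst; module ≡-Reasoning)
open import Relation.Nullary using (yes; no; contradiction)
open import Relation.Nullary.Decidable using (dec⇒maybe)
import Data.Nat as ℕ
open import Algebra.Properties.Semiring.Sum ℤ.+-*-semiring using (sum; sum-cong-≗; ∑-distrib-+; *-distribˡ-sum; sum-replicate-zero)

-- The ring of formal power series

-- Multiplication unfolds definitionally as
-- (f * g) (suc n) = f 0 ℤ.* g (suc n) ℤ.+ (shift f * g) n.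
shift : PowerSeries → PowerSeries
shift f n = f (suc n)

neg : PowerSeries → PowerSeries
neg f n = ℤ.- f n

*-cong : ∀ {f f′ g g′} → f ≗ f′ → g ≗ g′ → f * g ≗ f′ * g′
*-cong f≗f′ g≗g′ n = sum-cong-≗ {suc n} λ j → cong₂ ℤ._*_ (f≗f′ (toℕ j)) (g≗g′ (n ∸ toℕ j))

*-distribʳ-+ : ∀ f g h → (g + h) * f ≗ g * f + h * f
*-distribʳ-+ f g h n = trans
  (sum-cong-≗ {suc n} λ j → ℤ.*-distribʳ-+ (f (n ∸ toℕ j)) (g (toℕ j)) (h (toℕ j)))
  (∑-distrib-+ {suc n} (λ j → g (toℕ j) ℤ.* f (n ∸ toℕ j)) (λ j → h (toℕ j) ℤ.* f (n ∸ toℕ j)))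

*-scale : ∀ c f g n → ((λ k → c ℤ.* f k) * g) n ≡ c ℤ.* (f * g) n
*-scale c f g n = trans
  (sum-cong-≗ {suc n} λ j → ℤ.*-assoc c (f (toℕ j)) (g (n ∸ toℕ j)))
  (sym (*-distribˡ-sum {suc n} c λ j → f (toℕ j) ℤ.* g (n ∸ toℕ j)))

const-* : ∀ c f n → (const c * f) n ≡ c ℤ.* f n
const-* c f zero    = ℤ.+-identityʳ _
const-* c f (suc n) = trans
  (cong (ℤ._+_ (c ℤ.* f (suc n))) (sum-replicate-zero (suc n)))
  (ℤ.+-identityʳ _)

-- Mirror image of the definitional unfolding: it peels off the last summand instead of the first.
-- Commutativity needs both, since swapping the factors reverses the sum.
*-sucʳ : ∀ f g n → (f * g) (suc n) ≡ (f * shift g) n ℤ.+ f (suc n) ℤ.* g 0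
*-sucʳ f g zero    =
  solve 2 (λ a b → a :+ (b :+ con 0ℤ) := (a :+ con 0ℤ) :+ b) refl (f 0 ℤ.* g 1) (f 1 ℤ.* g 0)
  where open +-*-Solver
*-sucʳ f g (suc n) = trans
  (cong (ℤ._+_ (f 0 ℤ.* g (suc (suc n)))) (*-sucʳ (shift f) g n))
  (sym (ℤ.+-assoc (f 0 ℤ.* g (suc (suc n))) _ _))

*-comm : ∀ f g → f * g ≗ g * f
*-comm f g zero    = cong (ℤ._+ 0ℤ) (ℤ.*-comm (f 0) (g 0))
*-comm f g (suc n) = begin
  f 0 ℤ.* g (suc n) ℤ.+ (shift f * g) n  ≡⟨ ℤ.+-comm (f 0 ℤ.* g (suc n)) _ ⟩
  (shift f * g) n ℤ.+ f 0 ℤ.* g (suc n)  ≡⟨ cong₂ ℤ._+_ (*-comm (shift f) g n) (ℤ.*-comm (f 0) _) ⟩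
  (g * shift f) n ℤ.+ g (suc n) ℤ.* f 0  ≡⟨ *-sucʳ g f n ⟨
  (g * f) (suc n)                        ∎
  where open ≡-Reasoning

*-assoc : ∀ f g h → (f * g) * h ≗ f * (g * h)
*-assoc f g h zero    =
  solve 3 (λ a b c → (a :* b :+ con 0ℤ) :* c :+ con 0ℤ := a :* (b :* c :+ con 0ℤ) :+ con 0ℤ)
    refl (f 0) (g 0) (h 0)
  where open +-*-Solver
*-assoc f g h (suc n) = begin
  -- By computation `shift (f * g)` is `f 0` times `shift g`, plus `shift f * g`. The product with
  -- `h` is distributed over these two series, and the induction hypothesis applies to the second.
  (f 0 ℤ.* g 0 ℤ.+ 0ℤ) ℤ.* h (suc n) ℤ.+ (((λ k → f 0 ℤ.* g (suc k)) + shift f * g) * h) n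
    ≡⟨ cong (ℤ._+_ head) (*-distribʳ-+ h (λ k → f 0 ℤ.* g (suc k)) (shift f * g) n) ⟩
  (f 0 ℤ.* g 0 ℤ.+ 0ℤ) ℤ.* h (suc n) ℤ.+
    (((λ k → f 0 ℤ.* g (suc k)) * h) n ℤ.+ ((shift f * g) * h) n)
    ≡⟨ cong (ℤ._+_ head) (cong₂ ℤ._+_ (*-scale (f 0) (shift g) h n) (*-assoc (shift f) g h n)) ⟩
  (f 0 ℤ.* g 0 ℤ.+ 0ℤ) ℤ.* h (suc n) ℤ.+
    (f 0 ℤ.* (shift g * h) n ℤ.+ (shift f * (g * h)) n)
    ≡⟨ solve 5 (λ a b c d e → (a :* b :+ con 0ℤ) :* c :+ (a :* d :+ e) := a :* (b :* c :+ d) :+ e)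
         refl (f 0) (g 0) (h (suc n)) ((shift g * h) n) ((shift f * (g * h)) n) ⟩
  (f * (g * h)) (suc n) ∎
  where
  head : ℤ
  head = (f 0 ℤ.* g 0 ℤ.+ 0ℤ) ℤ.* h (suc n)
  open ≡-Reasoning
  open +-*-Solver

const-0 : const 0ℤ ≗ (λ _ → 0ℤ)
const-0 zero    = refl
const-0 (suc _) = refl

*-identityˡ : ∀ f → const 1ℤ * f ≗ f
*-identityˡ f n = trans (const-* 1ℤ f n) (ℤ.*-identityˡ (f n))

powerSeriesRing : CommutativeRing 0ℓ 0ℓ
powerSeriesRing = record
  { Carrier = PowerSeries
  ; _≈_     = _≗_
  ; _+_     = _+_
  ; _*_     = _*_
  ; -_      = neg
  ; 0#      = λ _ → 0ℤ
  ; 1#      = const 1ℤ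
  ; isCommutativeRing = record
    { isRing = record
      { +-isAbelianGroup = Pointwise.isAbelianGroup ℕ ℤ.+-0-isAbelianGroup
      ; *-cong     = *-cong
      ; *-assoc    = *-assoc
      ; *-identity = *-identityˡ , λ f n → trans (*-comm f (const 1ℤ) n) (*-identityˡ f n)
      ; distrib    =
          (λ f g h n → trans (*-comm f (g + h) n)
            (trans (*-distribʳ-+ f g h n) (cong₂ ℤ._+_ (*-comm g f n) (*-comm h f n))))
        , *-distribʳ-+
      }
    ; *-comm = *-comm
    }
  }

-- Equality of power series is not decidable, so the ring solver takes its coefficients from ℤ and
-- embeds them as constant series.
const-homomorphism : ℤ.+-*-rawRing -Raw-AlmostCommutative⟶ fromCommutativeRing powerSeriesRing
const-homomorphism = record
  { ⟦_⟧    = const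
  ; +-homo = λ { _ _ zero → refl ; _ _ (suc _) → refl }
  ; *-homo = λ { a b zero    → sym (const-* a (const b) zero)
               ; a b (suc n) → sym (trans (const-* a (const b) (suc n)) (ℤ.*-zeroʳ a)) }
  ; -‿homo = λ { _ zero → refl ; _ (suc _) → refl }
  ; 0-homo = const-0
  ; 1-homo = λ _ → refl
  }

module PowerSeriesSolver = RingSolver
  ℤ.+-*-rawRing (fromCommutativeRing powerSeriesRing) const-homomorphism
  (λ a b → Maybe.map (λ a≡b n → cong (λ c → const c n) a≡b) (dec⇒maybe (a ℤ.≟ b)))

-- Elimination

-- `L` and `K` will be the constant series of ℓ and m. With them as variables, each cubic is one
-- polynomial identity in five indeterminates.
module _ (L K P Q : PowerSeries)
         (P-equation : P ≗ x + (L * (P * P) + K * (Q * P)))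
         (Q-equation : Q ≗ x + L * (P * Q)) where

  private
    E₁ E₂ : PowerSeries
    E₁ = P - (x + (L * (P * P) + K * (Q * P)))
    E₂ = Q - (x + L * (P * Q))

    -- Membership in the ideal generated by `E₁` and `E₂`: each cubic only has to supply its
    -- cofactors `u` and `v`.
    combination-vanishes : ∀ u v → u * E₁ + v * E₂ ≗ const (+ 0)
    combination-vanishes u v n = trans
      (+-cong (*-cong {f = u} (λ _ → refl) (λ k → ℤ.i≡j⇒i-j≡0 (P-equation k)))
              (*-cong {f = v} (λ _ → refl) (λ k → ℤ.i≡j⇒i-j≡0 (Q-equation k))) n)
      (trans (+-cong (zeroʳ u) (zeroʳ v) n) (sym (const-0 n)))
      where open CommutativeRing powerSeriesRing using (+-cong; zeroʳ)

  -- Multiplying the equation of P by 1 − L P makes the term in Q reducible by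
  -- (1 − L P) Q = x.
  cubic-low : L ^ 2 * P ^ 3 - const (+ 2) * L * P ^ 2 + ((L - K) * x + const (+ 1)) * P - x
              ≗ const (+ 0)
  cubic-low n = trans
    (solve 5 (λ l k z p q →
        -- Powers are written out as `_^_` unfolds, with a final factor 1, so that the solved
        -- identity matches the statement by computation.
        l :* (l :* con 1ℤ) :* (p :* (p :* (p :* con 1ℤ)))
          :- con (+ 2) :* l :* (p :* (p :* con 1ℤ))
          :+ ((l :- k) :* z :+ con 1ℤ) :* p
          :- z
        := (con 1ℤ :- l :* p) :* (p :- (z :+ (l :* (p :* p) :+ k :* (q :* p))))
           :+ (k :* p) :* (q :- (z :+ l :* (p :* q))))
      (λ _ → refl) L K x P Q n)
    (combination-vanishes (const 1ℤ - L * P) (K * P) n)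
    where open PowerSeriesSolver

  -- Multiplying the equation of P by L Q² makes every occurrence of P part of
  -- a factor L P Q = Q − x.
  cubic-high : K * Q ^ 3 + (L - K) * x * Q ^ 2 - x * Q + x ^ 2 ≗ const (+ 0)
  cubic-high n = trans
    (solve 5 (λ l k z p q →
        k :* (q :* (q :* (q :* con 1ℤ)))
          :+ (l :- k) :* z :* (q :* (q :* con 1ℤ))
          :- z :* q
          :+ z :* (z :* con 1ℤ)
        := (:- (l :* (q :* q))) :* (p :- (z :+ (l :* (p :* p) :+ k :* (q :* p))))
           :+ (l :* (p :* q) :- z :+ k :* (q :* q)) :* (q :- (z :+ l :* (p :* q))))
      (λ _ → refl) L K x P Q n)
    (combination-vanishes (neg (L * (Q * Q))) (L * (P * Q) - x + K * (Q * Q)) n)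
    where open PowerSeriesSolver

-- Cardinalities

-- Conjugating `e` by the two enumerations gives a bijection between `Fin` types. In particular a
-- cardinality does not depend on the chosen enumeration.
card-cong : ∀ {X Y : Set} → X ↔ Y → (p : Finite X) (q : Finite Y) → card p ≡ card q
card-cong e (_ , f) (_ , g) = ↔⇒≡ (↔-trans f (↔-trans e (↔-sym g)))

card-ΣFin : ∀ {n} {B : Fin n → Set} (h : ∀ i → Finite (B i)) {g : Fin n → ℤ} →
            (∀ i → + card (h i) ≡ g i) → + card (finite-ΣFin h) ≡ sum g
card-ΣFin {zero}  h h≡g = refl
card-ΣFin {suc n} h h≡g = trans
  (ℤ.pos-+ (card (h zero)) _)
  (cong₂ ℤ._+_ (h≡g zero) (card-ΣFin (λ i → h (suc i)) (λ i → h≡g (suc i))))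

card-× : ∀ {X Y : Set} (p : Finite X) (q : Finite Y) → card (finite-× p q) ≡ card p ℕ.* card q
card-× (k , _) q = card-const k
  where
  card-const : ∀ k → card (finite-ΣFin {k} (λ _ → q)) ≡ k ℕ.* card q
  card-const zero    = refl
  card-const (suc k) = cong (card q ℕ.+_) (card-const k)

pos-card-× : ∀ {X Y : Set} (p : Finite X) (q : Finite Y) {a b} →
             + card p ≡ a → + card q ≡ b → + card (finite-× p q) ≡ a ℤ.* b
pos-card-× p q p≡a q≡b = trans
  (trans (cong +_ (card-× p q)) (ℤ.pos-* (card p) (card q)))
  (cong₂ ℤ._*_ p≡a q≡b)

-- Indexed exactly like the sum in the Cauchy product, so that its cardinality is a coefficient of
-- `f * g` term by term.
Convolution : (ℕ → Set) → (ℕ → Set) → ℕ → Set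
Convolution X Y n = Σ[ p ∈ Fin (suc n) ] X (toℕ p) × Y (n ∸ toℕ p)

finite-Convolution : ∀ {X Y : ℕ → Set} → (∀ n → Finite (X n)) → (∀ n → Finite (Y n)) →
                     ∀ n → Finite (Convolution X Y n)
finite-Convolution fX fY n = finite-ΣFin λ p → finite-× (fX (toℕ p)) (fY (n ∸ toℕ p))

card-Convolution : ∀ {X Y : ℕ → Set} (fX : ∀ n → Finite (X n)) (fY : ∀ n → Finite (Y n)) {f g : PowerSeries} →
                   (∀ n → + card (fX n) ≡ f n) → (∀ n → + card (fY n) ≡ g n) →
                   ∀ n → + card (finite-Convolution fX fY n) ≡ (f * g) n
card-Convolution fX fY X≡f Y≡g n = card-ΣFin {suc n} (λ p → finite-× (fX (toℕ p)) (fY (n ∸ toℕ p))) λ p →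
  pos-card-× (fX (toℕ p)) (fY (n ∸ toℕ p)) (X≡f (toℕ p)) (Y≡g (n ∸ toℕ p))

-- Counting colored trees

-- Either the root is the only vertex, or `j` is the color of its first child. In the second case
-- the root stays with the remaining children, so the two sizes add up to `n` and the second tree
-- keeps root color `i`. The orientation `1 ≡ n` is what the size equation of `node []` computes to.
Decomposition : ∀ {k} → ColoringMatrix k → (Fin k → ℕ → Set) → Fin k → ℕ → Set
Decomposition {k} M C i n = 1 ≡ n ⊎ Σ[ j ∈ Fin k ] (M i j ≡ 1F × Convolution (C j) (C i) n)

-- Stated for an arbitrary family C: for C = ColoredTree M the type checker
-- would unfold the enumeration of all trees when comparing cardinalities.
module _ {k} (M : ColoringMatrix k) {C : Fin k → ℕ → Set} (fC : ∀ i n → Finite (C i n))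
         {f : Fin k → PowerSeries} (C≡f : ∀ i n → + card (fC i n) ≡ f i n) where

  finite-root : ∀ n → Finite (1 ≡ n)
  finite-root n = finite-dec (1 ≟ⁿ n) ≡-irrelevant

  card-root : ∀ n → + card (finite-root n) ≡ x n
  card-root 0             = refl
  card-root 1             = refl
  card-root (suc (suc n)) = refl

  finite-allowed : ∀ i j → Finite (M i j ≡ 1F)
  finite-allowed i j = finite-dec (M i j ≟ᶠ 1F) Fin-≡-irrelevant

  card-allowed : ∀ i j → + card (finite-allowed i j) ≡ + toℕ (M i j)
  card-allowed i j with M i j
  ... | 0F = refl
  ... | 1F = refl

  finite-branch : ∀ i n j → Finite (M i j ≡ 1F × Convolution (C j) (C i) n)
  finite-branch i n j = finite-× (finite-allowed i j) (finite-Convolution (fC j) (fC i) n)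

  finite-branches : ∀ i n → Finite (Σ[ j ∈ Fin k ] (M i j ≡ 1F × Convolution (C j) (C i) n))
  finite-branches i n = finite-ΣFin (finite-branch i n)

  card-branches : ∀ i n → + card (finite-branches i n) ≡ sum (λ j → + toℕ (M i j) ℤ.* (f j * f i) n)
  card-branches i n = card-ΣFin (finite-branch i n) λ j →
    pos-card-× (finite-allowed i j) (finite-Convolution (fC j) (fC i) n)
      (card-allowed i j) (card-Convolution (fC j) (fC i) (C≡f j) (C≡f i) n)

  recurrence : (∀ i n → C i n ↔ Decomposition M C i n) →
               ∀ i n → f i n ≡ x n ℤ.+ sum (λ j → + toℕ (M i j) ℤ.* (f j * f i) n)
  recurrence decompose i n = begin
    f i n                                                   ≡⟨ C≡f i n ⟨
    + card (fC i n)                                         ≡⟨ cong +_ (card-cong (decompose i n) (fC i n) (finite-⊎ (finite-root n) (finite-branches i n))) ⟩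
    + (card (finite-root n) ℕ.+ card (finite-branches i n)) ≡⟨ ℤ.pos-+ (card (finite-root n)) _ ⟩
    + card (finite-root n) ℤ.+ + card (finite-branches i n) ≡⟨ cong₂ ℤ._+_ (card-root n) (card-branches i n) ⟩
    x n ℤ.+ sum (λ j → + toℕ (M i j) ℤ.* (f j * f i) n)     ∎
    where open ≡-Reasoning

module _ {k} (M : ColoringMatrix k) where

  detach : ∀ i n → ColoredTree M i n ↔ Decomposition M (ColoredTree M) i n
  detach i n = mk↔ₛ′ to from to∘from from∘to
    where
    -- Here `a` is the size of the detached subtree and `b` that of the remaining forest; the second
    -- tree has size `suc b`, because it contains the root.
    first : ∀ {a b} → suc (a ℕ.+ b) ≡ n → a < suc n
    first {a} {b} e = s≤s (≤-trans (m≤m+n a (suc b)) (≤-reflexive (trans (+-suc a b) e)))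

    rest : ∀ {a b p} → suc (a ℕ.+ b) ≡ n → a ≡ p → suc b ≡ n ∸ p
    rest {a} {b} e refl = sym (trans
      (cong (_∸ a) (trans (sym e) (sym (+-suc a b))))
      (m+n∸m≡n a (suc b)))

    total : ∀ {a b} (p : Fin (suc n)) → a ≡ toℕ p → suc b ≡ n ∸ toℕ p → suc (a ℕ.+ b) ≡ n
    total {a} {b} p a≡p b≡n∸p = trans (sym (+-suc a b))
      (trans (cong₂ ℕ._+_ a≡p b≡n∸p) (m+[n∸m]≡n (toℕ≤pred[n] p)))

    to : ColoredTree M i n → Decomposition M (ColoredTree M) i n
    to ((node [] , e) , color _ [] , _ , _) = inj₁ e
    to ((node (t ∷ ts) , e) , color _ (c ∷ cs) , ((a , v) , w) , r) =
      inj₂ (rootColor c , subst (λ i → M i (rootColor c) ≡ 1F) r a , fromℕ< (first {size t} e)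
           , ((t , sym (toℕ-fromℕ< (first e))) , c , v , refl)
           , ((node ts , rest e (sym (toℕ-fromℕ< (first e)))) , color _ cs , w , r))

    from : Decomposition M (ColoredTree M) i n → ColoredTree M i n
    from (inj₁ e) = (node [] , e) , color i [] , tt , refl
    from (inj₂ (_ , a , p , ((t , e) , c , v , refl) , ((node ts , e′) , color _ cs , w , refl))) =
      (node (t ∷ ts) , total p e e′) , color _ (c ∷ cs) , ((a , v) , w) , refl

    -- A round trip changes only the split index and the size proofs. The index is determined by the
    -- size of the first tree, and equality proofs in ℕ are unique.
    pair-≡ : ∀ {t u j} {c : Coloring k t} {d : Coloring k u}
             {v : IsColoring M c × rootColor c ≡ j} {w : IsColoring M d × rootColor d ≡ i}
             {p q : Fin (suc n)}
             {e : size t ≡ toℕ p} {e′ : size u ≡ n ∸ toℕ p}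
             {f : size t ≡ toℕ q} {f′ : size u ≡ n ∸ toℕ q} →
             _≡_ {A = Convolution (ColoredTree M j) (ColoredTree M i) n}
               (p , ((t , e) , c , v) , ((u , e′) , d , w))
               (q , ((t , f) , c , v) , ((u , f′) , d , w))
    pair-≡ {e = e} {e′} {f} {f′} with refl ← toℕ-injective (trans (sym e) f)
      with refl ← ≡-irrelevant e f with refl ← ≡-irrelevant e′ f′ = refl

    to∘from : ∀ y → to (from y) ≡ y
    to∘from (inj₁ e) = refl
    to∘from (inj₂ (_ , a , p , ((t , e) , c , v , refl) , ((node ts , e′) , color _ cs , w , refl))) =
      cong (λ z → inj₂ (rootColor c , a , z)) pair-≡

    from∘to : ∀ y → from (to y) ≡ y
    from∘to ((node [] , e) , color _ [] , _ , refl) = refl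
    from∘to ((node (t ∷ ts) , e) , color _ (c ∷ cs) , ((a , v) , w) , refl) =
      cong (λ e → (node (t ∷ ts) , e) , color _ (c ∷ cs) , ((a , v) , w) , refl) (≡-irrelevant _ e)

  F-treeCount : ∀ i n → F M i n ≡ + treeCount M i n
  F-treeCount i zero    = cong +_ (card-cong
    (mk↔ₛ′ (λ ()) (λ { ((node _ , ()) , _) }) (λ { ((node _ , ()) , _) }) (λ ()))
    -- An enumeration of an empty type whose cardinality computes to 0, matching the constant
    -- coefficient of `F`. Every tree has at least one vertex.
    (finite-ΣFin {0} {λ ()} (λ ())) (finite-ColoredTree M i 0))
  F-treeCount i (suc n) = refl

  F-recurrence : ∀ i n → F M i n ≡ x n ℤ.+ sum (λ j → + toℕ (M i j) ℤ.* (F M j * F M i) n)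
  F-recurrence = recurrence M (finite-ColoredTree M) (λ i n → sym (F-treeCount i n)) detach

  recolor-allowed : ∀ {i i′ ts} → M i ≗ M i′ →
                    (cs : All (Coloring k) ts) → AllowedBelow M i cs → AllowedBelow M i′ cs
  recolor-allowed row []       _             = tt
  recolor-allowed row (c ∷ cs) ((a , v) , w) = (trans (sym (row _)) a , v) , recolor-allowed row cs w

  -- Only the root changes color. It has no parent, so its color is tested only against its
  -- children, that is, through its row of `M`.
  recolor : ∀ {i i′ n} → M i ≗ M i′ → ColoredTree M i n → ColoredTree M i′ n
  recolor {i′ = i′} row (t , color _ cs , w , refl) = t , color i′ cs , recolor-allowed row cs w , refl

  recolor-inverse : ∀ {i i′ n} (row : M i ≗ M i′) (row′ : M i′ ≗ M i) (t : ColoredTree M i n) →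
                    recolor row′ (recolor row t) ≡ t
  recolor-inverse row row′ (t , color i cs , w , refl) =
    cong (λ w → t , color i cs , w , refl) (allowedBelow-irrelevant M i cs _ w)

  F-row : ∀ {i i′} → M i ≗ M i′ → F M i ≗ F M i′
  F-row {i} {i′} row n = trans (F-treeCount i n) (trans
    (cong +_ (card-cong
      (mk↔ₛ′ (recolor row) (recolor row⁻¹) (recolor-inverse row⁻¹ row) (recolor-inverse row row⁻¹))
      (finite-ColoredTree M i n) (finite-ColoredTree M i′ n)))
    (sym (F-treeCount i′ n)))
    where
    row⁻¹ : M i′ ≗ M i
    row⁻¹ j = sym (row j)

-- The matrix A(ℓ, m)

-- The low indices come first in `Fin (ℓ + m)`, so induction on ℓ peels them off one at a time until
-- a constant sum of m terms is left.
sum-two-blocks : ∀ ℓ {m} (g : Fin (ℓ ℕ.+ m) → ℤ) {a b} →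
                 (∀ j → toℕ j < ℓ → g j ≡ a) → (∀ j → ℓ ≤ toℕ j → g j ≡ b) →
                 sum g ≡ + ℓ ℤ.* a ℤ.+ + m ℤ.* b
sum-two-blocks zero {m} g {a} {b} _ high =
  trans (sum-const m g (λ j → high j z≤n))
        (sym (trans (cong (ℤ._+ (+ m ℤ.* b)) (ℤ.*-zeroˡ a)) (ℤ.+-identityˡ _)))
  where
  sum-const : ∀ m (g : Fin m → ℤ) → (∀ j → g j ≡ b) → sum g ≡ + m ℤ.* b
  sum-const zero    g g≡b = sym (ℤ.*-zeroˡ b)
  sum-const (suc m) g g≡b = trans
    (cong₂ ℤ._+_ (g≡b zero) (sum-const m (g ∘ suc) (g≡b ∘ suc)))
    (sym (ℤ.suc-* (+ m) b))
sum-two-blocks (suc ℓ) {m} g {a} {b} low high = begin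
  g zero ℤ.+ sum (g ∘ suc)
    ≡⟨ cong₂ ℤ._+_ (low zero z<s)
         (sum-two-blocks ℓ (g ∘ suc) (λ j j<ℓ → low (suc j) (s≤s j<ℓ)) (λ j ℓ≤j → high (suc j) (s≤s ℓ≤j))) ⟩
  a ℤ.+ (+ ℓ ℤ.* a ℤ.+ + m ℤ.* b)
    ≡⟨ ℤ.+-assoc a _ _ ⟨
  (a ℤ.+ + ℓ ℤ.* a) ℤ.+ + m ℤ.* b
    ≡⟨ cong (ℤ._+ (+ m ℤ.* b)) (ℤ.suc-* (+ ℓ) a) ⟨
  + suc ℓ ℤ.* a ℤ.+ + m ℤ.* b ∎
  where open ≡-Reasoning

sum-two-block-products : ∀ ℓ {m} (w : Fin (ℓ ℕ.+ m) → ℤ) (f : Fin (ℓ ℕ.+ m) → PowerSeries) {a b P Q} →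
  (∀ j → toℕ j < ℓ → w j ≡ a) → (∀ j → ℓ ≤ toℕ j → w j ≡ b) →
  (∀ j → toℕ j < ℓ → f j ≗ P) → (∀ j → ℓ ≤ toℕ j → f j ≗ Q) →
  ∀ G n → sum (λ j → w j ℤ.* (f j * G) n)
          ≡ + ℓ ℤ.* (a ℤ.* (P * G) n) ℤ.+ + m ℤ.* (b ℤ.* (Q * G) n)
sum-two-block-products ℓ w f w-low w-high f-low f-high G n =
  sum-two-blocks ℓ (λ j → w j ℤ.* (f j * G) n)
    (λ j j<ℓ → cong₂ ℤ._*_ (w-low j j<ℓ) (*-cong {g = G} (f-low j j<ℓ) (λ _ → refl) n))
    (λ j ℓ≤j → cong₂ ℤ._*_ (w-high j ℓ≤j) (*-cong {g = G} (f-high j ℓ≤j) (λ _ → refl) n))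

weight-1 : ∀ c f n → c ℤ.* (1ℤ ℤ.* f n) ≡ (const c * f) n
weight-1 c f n = trans (cong (ℤ._*_ c) (ℤ.*-identityˡ (f n))) (sym (const-* c f n))

weight-0 : ∀ c a → c ℤ.* (0ℤ ℤ.* a) ≡ 0ℤ
weight-0 c a = trans (cong (ℤ._*_ c) (ℤ.*-zeroˡ a)) (ℤ.*-zeroʳ c)

-- Abstract in f for the same reason as recurrence.
module _ (ℓ : ℕ) {m} (w : Fin (ℓ ℕ.+ m) → ℤ) (f : Fin (ℓ ℕ.+ m) → PowerSeries) (P Q G : PowerSeries)
         (f-low : ∀ j → toℕ j < ℓ → f j ≗ P) (f-high : ∀ j → ℓ ≤ toℕ j → f j ≗ Q)
         (G-recurrence : ∀ n → G n ≡ x n ℤ.+ sum (λ j → w j ℤ.* (f j * G) n)) where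

  -- The digits in the name are the weights on the low and the high block: 1, 1 is the row of a low
  -- color, and 1, 0 below that of a high one.
  equation-11 : (∀ j → toℕ j < ℓ → w j ≡ 1ℤ) → (∀ j → ℓ ≤ toℕ j → w j ≡ 1ℤ) →
                G ≗ x + (const (+ ℓ) * (P * G) + const (+ m) * (Q * G))
  equation-11 w-low w-high n = trans (G-recurrence n) (cong (ℤ._+_ (x n)) (trans
    (sum-two-block-products ℓ w f w-low w-high f-low f-high G n)
    (cong₂ ℤ._+_ (weight-1 (+ ℓ) (P * G) n) (weight-1 (+ m) (Q * G) n))))

  equation-10 : (∀ j → toℕ j < ℓ → w j ≡ 1ℤ) → (∀ j → ℓ ≤ toℕ j → w j ≡ 0ℤ) →
                G ≗ x + const (+ ℓ) * (P * G)
  equation-10 w-low w-high n = trans (G-recurrence n) (cong (ℤ._+_ (x n)) (trans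
    (sum-two-block-products ℓ w f w-low w-high f-low f-high G n)
    (trans (cong₂ ℤ._+_ (weight-1 (+ ℓ) (P * G) n) (weight-0 (+ m) ((Q * G) n)))
           (ℤ.+-identityʳ ((const (+ ℓ) * (P * G)) n)))))

module _ (ℓ m : ℕ) where

  A-low : ∀ {i} j → toℕ i < ℓ → A ℓ m i j ≡ 1F
  A-low {i} j i<ℓ with ℓ ≤ᵇ toℕ i in eq
  ... | false = refl
  ... | true  = contradiction (≤ᵇ⇒≤ ℓ (toℕ i) (subst T (sym eq) tt)) (<⇒≱ i<ℓ)

  -- Transfers `A-low`, a fact about rows, to columns: it yields the entries of a high row in the
  -- low columns.
  A-sym : ∀ i j → A ℓ m i j ≡ A ℓ m j i
  A-sym i j = cong (λ b → if b then 0F else 1F) (∧-comm (ℓ ≤ᵇ toℕ i) (ℓ ≤ᵇ toℕ j))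

  A-high : ∀ {i j} → ℓ ≤ toℕ i → ℓ ≤ toℕ j → A ℓ m i j ≡ 0F
  A-high {i} {j} ℓ≤i ℓ≤j with ℓ ≤ᵇ toℕ i | ≤⇒≤ᵇ ℓ≤i | ℓ ≤ᵇ toℕ j | ≤⇒≤ᵇ ℓ≤j
  ... | true | _ | true | _ = refl

  A-row-high : ∀ {i i′} → ℓ ≤ toℕ i → ℓ ≤ toℕ i′ → A ℓ m i ≗ A ℓ m i′
  A-row-high {i} {i′} ℓ≤i ℓ≤i′ j with ℓ ≤? toℕ j
  ... | yes ℓ≤j = trans (A-high ℓ≤i ℓ≤j) (sym (A-high ℓ≤i′ ℓ≤j))
  ... | no  ℓ≰j = trans (A-high-low i) (sym (A-high-low i′))
    where
    A-high-low : ∀ i → A ℓ m i j ≡ 1F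
    A-high-low i = trans (A-sym i j) (A-low i (≰⇒> ℓ≰j))

  private
    F′ : Fin (ℓ ℕ.+ m) → PowerSeries
    F′ = F (A ℓ m)

  -- `p` and `q` are representatives of the two classes of colors with equal rows; every `F′ j`
  -- equals the series of one of them.
  module _ {p q : Fin (ℓ ℕ.+ m)} (p<ℓ : toℕ p < ℓ) (ℓ≤q : ℓ ≤ toℕ q) where

    private
      P Q : PowerSeries
      P = F′ p
      Q = F′ q

    F-low : ∀ j → toℕ j < ℓ → F′ j ≗ P
    F-low _ j<ℓ = F-row (A ℓ m) λ j → trans (A-low j j<ℓ) (sym (A-low j p<ℓ))

    F-high : ∀ j → ℓ ≤ toℕ j → F′ j ≗ Q
    F-high _ ℓ≤j = F-row (A ℓ m) (A-row-high ℓ≤j ℓ≤q)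

    F-equation-low : P ≗ x + (const (+ ℓ) * (P * P) + const (+ m) * (Q * P))
    F-equation-low = equation-11 ℓ (λ j → + toℕ (A ℓ m p j)) F′ P Q P
      F-low F-high (F-recurrence (A ℓ m) p)
      (λ j _ → cong (λ a → + toℕ a) (A-low j p<ℓ)) (λ j _ → cong (λ a → + toℕ a) (A-low j p<ℓ))

    F-equation-high : Q ≗ x + const (+ ℓ) * (P * Q)
    F-equation-high = equation-10 ℓ (λ j → + toℕ (A ℓ m q j)) F′ P Q Q
      F-low F-high (F-recurrence (A ℓ m) q)
      (λ j j<ℓ → cong (λ a → + toℕ a) (trans (A-sym q j) (A-low q j<ℓ)))
      (λ j ℓ≤j → cong (λ a → + toℕ a) (A-high ℓ≤q ℓ≤j))

theorem34 : (ℓ m : ℕ) → .{{NonZero ℓ}} → .{{NonZero m}} →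
    ((i : Fin (ℓ ℕ.+ m)) → toℕ i < ℓ →
    (const (+ ℓ) ^ 2 * F (A ℓ m) i ^ 3
    - const (+ 2) * const (+ ℓ) * F (A ℓ m) i ^ 2
    + ((const (+ ℓ) - const (+ m)) * x + const (+ 1)) * F (A ℓ m) i
    - x)
    ≗ const (+ 0))
    ×
    ((i : Fin (ℓ ℕ.+ m)) → ℓ ≤ toℕ i →
    (const (+ m) * F (A ℓ m) i ^ 3
    + (const (+ ℓ) - const (+ m)) * x * F (A ℓ m) i ^ 2
    - x * F (A ℓ m) i
    + x ^ 2)
    ≗ const (+ 0))
theorem34 ℓ m =
    (λ i i<ℓ → cubic-low (const (+ ℓ)) (const (+ m)) (F (A ℓ m) i) (F (A ℓ m) high)
      (F-equation-low ℓ m {i} {high} i<ℓ ℓ≤high) (F-equation-high ℓ m {i} {high} i<ℓ ℓ≤high))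
  , (λ i ℓ≤i → cubic-high (const (+ ℓ)) (const (+ m)) (F (A ℓ m) low) (F (A ℓ m) i)
      (F-equation-low ℓ m {low} {i} low<ℓ ℓ≤i) (F-equation-high ℓ m {low} {i} low<ℓ ℓ≤i))
  where
  0<ℓ : 0 < ℓ
  0<ℓ = >-nonZero⁻¹ ℓ

  0<ℓ+m : 0 < ℓ ℕ.+ m
  0<ℓ+m = ≤-trans 0<ℓ (m≤m+n ℓ m)

  ℓ<ℓ+m : ℓ < ℓ ℕ.+ m
  ℓ<ℓ+m = m<m+n ℓ (>-nonZero⁻¹ m)

  -- Each cubic eliminates the series of the other class, so that class needs a representative. The
  -- least indices 0 and ℓ serve, and they exist because ℓ and m are positive.
  low high : Fin (ℓ ℕ.+ m)
  low  = fromℕ< 0<ℓ+m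
  high = fromℕ< ℓ<ℓ+m

  low<ℓ : toℕ low < ℓ
  low<ℓ = subst (_< ℓ) (sym (toℕ-fromℕ< 0<ℓ+m)) 0<ℓ

  ℓ≤high : ℓ ≤ toℕ high
  ℓ≤high = ≤-reflexive (sym (toℕ-fromℕ< ℓ<ℓ+m))
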